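{- Fix an error probability $\delta\in(0,1)$. For all integers $N\ge 1$ and $m\ge 1$ with $m>\lg(1/\delta)$, there exists a (randomized) list-asymmetric-coding scheme $(\mathsf{Enc},\mathsf{Dec})$ with message length $m$ that is $\alpha$-competitive with error probability $\delta$, where $$\alpha=\frac{m}{m-\lg(1/\delta)}$$ (so $\alpha=1+o(1)$ as $m\to\infty$ with $\delta$ fixed). That is: for every list $L$ of subsets of $[N]$ with $|L|\le 2^{m/\alpha}$ and every $S\in L$, $\Pr[\mathsf{Dec}_L(\mathsf{Enc}(S))=S]\ge 1-\delta$, the probability being over the randomness of the scheme.
   Context: $[N]=\{1,\dots,N\}$ and $\lg$ is the base-2 logarithm. A list $L$ is an ordered collection of distinct subsets of $[N]$. A (randomized) scheme consists of an encoder $\mathsf{Enc}:2^{[N]}\to\{0,1\}^m$ and decoders $\mathsf{Dec}_L:\{0,1\}^m\to 2^{[N]}$, one for each list $L$ (the decoder's side information). Encoder and decoder both have access to a shared random string, which is an auxiliary input to both; the encoder does not depend on $L$. For $N,m,\alpha\ge 1$, the scheme is an $\alpha$-competitive list-asymmetric-coding scheme with error probability $\delta$ if for every list $L$ of subsets of $[N]$ with $|L|\le 2^{m/\alpha}$ and every $S\in L$, $\Pr[\mathsf{Dec}_L(\mathsf{Enc}(S))=S]\ge 1-\delta$. No computational efficiency is required. -}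

module Defs where

open import Algebra.Definitions.RawSemiring using () renaming (_^_ to pow)
open import Data.Bool.Base using (Bool; true; false)
import Data.Bool.Properties as Bool
open import Data.Fin.Subset using (Subset)
open import Data.Integer.Base as ℤ using (ℤ; +_; -[1+_])
open import Data.List.Base using (List; []; _∷_; length; filter; cartesianProductWith)
open import Data.List.Membership.Propositional using (_∈_)
open import Data.List.Relation.Unary.Unique.Propositional using (Unique)
open import Data.Nat.Base as ℕ using (ℕ; zero; suc)
open import Data.Nat.Properties using (m^n≢0)
open import Data.Product.Base using (Σ; ∃; ∃-syntax; Σ-syntax; _×_; _,_; proj₁)
open import Data.Rational.Base
  using (ℚ; 0ℚ; 1ℚ; ½; _<_; _≤_; _+_; _-_; _*_; _/_; ↥_; ↧ₙ_; +-*-rawSemiring)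
open import Data.Sum.Base using (_⊎_)
open import Data.Vec.Base as Vec using (Vec)
import Data.Vec.Properties as Vec
open import Function.Bundles using (_⇔_)
open import Relation.Binary.PropositionalEquality using (_≡_)
open import Relation.Nullary.Negation using (¬_)
open import Relation.Unary using (Pred; Decidable)
open import Level using (0ℓ)

-- Real numbers as two-sided Dedekind cuts of ℚ.  The operations below act
-- on arbitrary pairs (L , U); each computes the cut of the intended real
-- number on the stated domain and is meaningless outside it.

record Cut : Set₁ where
  field
    L U : ℚ → Set    -- L q means q < x,  U q means x < q

open Cut public

record IsReal (x : Cut) : Set where
  field
    inhabited-L : ∃ (L x)
    inhabited-U : ∃ (U x)
    rounded-L   : ∀ q → L x q ⇔ (∃[ r ] q < r × L x r)
    rounded-U   : ∀ q → U x q ⇔ (∃[ r ] r < q × U x r)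
    disjoint    : ∀ q → ¬ (L x q × U x q)
    located     : ∀ q r → q < r → L x q ⊎ U x r

infix 4 _<ᶜ_ _≤ᶜ_

_<ᶜ_ _≤ᶜ_ : Cut → Cut → Set
x <ᶜ y = ∃[ q ] U x q × L y q
x ≤ᶜ y = ∀ q → L x q → L y q

fromℚ : ℚ → Cut
fromℚ p .L q = q < p
fromℚ p .U q = p < q

fromℕ : ℕ → Cut
fromℕ n = fromℚ (+ n / 1)

infixl 6 _-ᶜ_
infixl 7 _÷ᶜ_

_-ᶜ_ : Cut → Cut → Cut
(x -ᶜ y) .L q = ∃[ a ] ∃[ b ] L x a × U y b × q < a - b
(x -ᶜ y) .U q = ∃[ a ] ∃[ b ] U x a × L y b × a - b < q

-- Division of x ≥ 0 by y > 0.  An upper bound b of y is automatically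
-- positive, so q * b < a gives q < a ÷ b; a lower bound need not be.
_÷ᶜ_ : Cut → Cut → Cut
(x ÷ᶜ y) .L q = ∃[ a ] ∃[ b ] L x a × U y b × q * b < a
(x ÷ᶜ y) .U q = ∃[ a ] ∃[ b ] U x a × L y b × 0ℚ < b × a < q * b

infixr 8 _^_
_^_ : ℚ → ℕ → ℚ
_^_ = pow +-*-rawSemiring

2^ℤ_ : ℤ → ℚ
2^ℤ (+ n)    = (+ 2 / 1) ^ n
2^ℤ -[1+ n ] = ½ ^ suc n

-- For q = n / d in lowest terms and s > 0, comparing 2^(n/d) with s amounts
-- to comparing 2^n with s^d.
infix 4 2^_<_ _<2^_

2^_<_ : ℚ → ℚ → Set
2^ q < s = 0ℚ < s × 2^ℤ (↥ q) < s ^ (↧ₙ q)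

_<2^_ : ℚ → ℚ → Set
s <2^ q = s ≤ 0ℚ ⊎ s ^ (↧ₙ q) < 2^ℤ (↥ q)

-- 2^x, for any real x: the powers 2^r with r rational, r < x, approximate it
-- from below, those with r > x from above.
2^ᶜ_ : Cut → Cut
(2^ᶜ x) .L s = ∃[ r ] L x r × s <2^ r
(2^ᶜ x) .U s = ∃[ r ] U x r × 2^ r < s

-- The base-2 logarithm of a real x > 0.
lg : Cut → Cut
lg x .L q = ∃[ s ] L x s × 2^ q < s
lg x .U q = ∃[ s ] U x s × s <2^ q

-- Convergence; rational ε suffice by density.
_⟶_ : (ℕ → Cut) → ℚ → Set
f ⟶ l = ∀ ε → 0ℚ < ε → ∃[ M ] ∀ m → M ℕ.≤ m →
          fromℚ (l - ε) <ᶜ f m × f m <ᶜ fromℚ (l + ε)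

BitString : ℕ → Set
BitString = Vec Bool

bitStrings : ∀ k → List (BitString k)
bitStrings zero    = Vec.[] ∷ []
bitStrings (suc k) =
  cartesianProductWith Vec._∷_ (true ∷ false ∷ []) (bitStrings k)

-- The probability of P for a uniformly random string of k bits.
Pr : ∀ {k} {P : Pred (BitString k) 0ℓ} → Decidable P → ℚ
Pr {k} P? = + length (filter P? (bitStrings k)) / (2 ℕ.^ k)
  where instance _ = m^n≢0 2 k

SubsetList : ℕ → Set
SubsetList N = Σ[ Ss ∈ List (Subset N) ] Unique Ss

-- The first argument of Enc and Dec is the shared random string.
record Scheme (N m : ℕ) : Set where
  field
    randomBits : ℕ
    Enc        : BitString randomBits → Subset N → BitString m
    Dec        : BitString randomBits → SubsetList N → BitString m → Subset N

  success? : (Ss : SubsetList N) (S : Subset N) →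
             Decidable (λ ρ → Dec ρ Ss (Enc ρ S) ≡ S)
  success? Ss S ρ = Vec.≡-dec Bool._≟_ (Dec ρ Ss (Enc ρ S)) S

record IsCompetitive {N m : ℕ} (𝓢 : Scheme N m) (α δ : Cut) : Set where
  open Scheme 𝓢
  field
    1≤α     : fromℕ 1 ≤ᶜ α
    correct : (Ss : SubsetList N) →
              fromℕ (length (proj₁ Ss)) ≤ᶜ 2^ᶜ (fromℕ m ÷ᶜ α) →
              ∀ S → S ∈ proj₁ Ss →
              fromℕ 1 -ᶜ δ ≤ᶜ fromℚ (Pr (success? Ss S))

-- m / (m - lg (1/δ)), for m > lg (1/δ).
competitiveness : Cut → ℕ → Cut
competitiveness δ m = fromℕ m ÷ᶜ (fromℕ m -ᶜ lg (fromℕ 1 ÷ᶜ δ))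

{-# OPTIONS --safe #-}
module Submission where

-- The shared string is the key of a random GF(2)-linear hash from subsets of [N] to m bits: the
-- encoder sends the hash of S, the decoder returns the first set of L with that hash.  Distinct
-- sets collide with probability at most 2^-m, so by the union bound decoding fails with
-- probability at most |L| / 2^m, and 2^(m/α) = 2^(m - lg (1/δ)) = δ 2^m.  With δ given as a
-- Dedekind cut, the last step becomes |L| ≤ b 2^m for every rational b > δ.

open import Defs hiding (_^_)
open import Algebra.Bundles using (CommutativeRing)
import Algebra.Properties.CommutativeSemiring.Exp
open import Data.Bool.Base using (true; false; _xor_; if_then_else_)
import Data.Bool.Properties as Bool
import Data.Empty as Empty
open import Data.Fin.Subset using (Subset; ⊥)
open import Data.Integer.Base as ℤ using (+_; -[1+_]; _⊖_)
import Data.Integer.Properties as ℤ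
open import Data.List.Base using (List; []; _∷_; _++_; length; map; filter)
open import Data.List.Membership.Propositional using (_∈_)
import Data.List.Properties as List
open import Data.List.Relation.Unary.All as All using ()
open import Data.List.Relation.Unary.AllPairs using (_∷_)
open import Data.List.Relation.Unary.Any using (here; there)
open import Data.List.Relation.Unary.Unique.Propositional using (Unique)
open import Data.Nat.Base as ℕ using (ℕ; zero; suc; z≤n; s≤s)
open import Data.Nat.Coprimality as ℕ using (1-coprimeTo)
import Data.Nat.Properties as ℕ
open import Data.Product.Base using (_×_; _,_; ∃-syntax; proj₁; proj₂)
open import Data.Rational.Base
  using (ℚ; mkℚ; 0ℚ; 1ℚ; ½; _/_; 1/_; ↥_; ↧_; ↧ₙ_; toℚᵘ; *<*; *≤*; positive; nonNegative)
import Data.Rational.Properties as ℚ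
open import Data.Rational.Solver using (module +-*-Solver)
import Data.Rational.Unnormalised.Base as ℚᵘ
import Data.Rational.Unnormalised.Properties as ℚᵘ
open import Data.Sum.Base using (_⊎_; inj₁; inj₂)
open import Data.Vec.Base as Vec using ([]; _∷_; take; drop; zipWith)
import Data.Vec.Properties as Vec
open import Function.Base using (_∘_; case_of_)
open import Function.Bundles using (Equivalence)
open import Level using (0ℓ)
open import Relation.Binary.Definitions using (DecidableEquality; tri<; tri≈; tri>)
open import Relation.Binary.PropositionalEquality
  using (_≡_; _≢_; refl; sym; trans; cong; cong₂; subst; subst₂; module ≡-Reasoning)
open import Relation.Nullary using (¬_; yes; no; does; contradiction)
open import Relation.Unary using (Pred; Decidable)
open import Relation.Unary.Properties using (∁?)

-- Counting bit strings with a given property.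

module Counting where

  open import Data.Nat.Base using (_≤_; _+_; _*_; _^_)

  module _ {A : Set} where

    count : {P : Pred A 0ℓ} → Decidable P → List A → ℕ
    count P? xs = length (filter P? xs)

    module _ {P Q R : Pred A 0ℓ} (P? : Decidable P) (Q? : Decidable Q) (R? : Decidable R) where

      -- The union bound in counting form. Later `Q` is a collision with the head of a list and `R`
      -- is failure on its tail.
      count-⊎ : (∀ x → P x → Q x ⊎ R x) → ∀ xs → count P? xs ≤ count Q? xs + count R? xs
      count-⊎ P⊆Q∪R []       = z≤n
      count-⊎ P⊆Q∪R (x ∷ xs) with ih ← count-⊎ P⊆Q∪R xs | P? x | Q? x | R? x
      ... | yes p | no ¬q | no ¬r with P⊆Q∪R x p
      ...   | inj₁ q = contradiction q ¬q
      ...   | inj₂ r = contradiction r ¬r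
      count-⊎ P⊆Q∪R (x ∷ xs) | yes p | yes q | yes r =
        s≤s (ℕ.≤-trans ih (ℕ.+-monoʳ-≤ _ (ℕ.n≤1+n _)))
      count-⊎ P⊆Q∪R (x ∷ xs) | yes p | yes q | no  _ = s≤s ih
      count-⊎ P⊆Q∪R (x ∷ xs) | yes p | no  _ | yes r =
        ℕ.≤-trans (s≤s ih) (ℕ.≤-reflexive (sym (ℕ.+-suc _ _)))
      count-⊎ P⊆Q∪R (x ∷ xs) | no _ | yes _ | yes _ =
        ℕ.m≤n⇒m≤1+n (ℕ.≤-trans ih (ℕ.+-monoʳ-≤ _ (ℕ.n≤1+n _)))
      count-⊎ P⊆Q∪R (x ∷ xs) | no _ | yes _ | no  _ = ℕ.m≤n⇒m≤1+n ih
      count-⊎ P⊆Q∪R (x ∷ xs) | no _ | no  _ | yes _ = ℕ.≤-trans ih (ℕ.+-monoʳ-≤ _ (ℕ.n≤1+n _))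
      count-⊎ P⊆Q∪R (x ∷ xs) | no _ | no  _ | no  _ = ih

    module _ {P : Pred A 0ℓ} (P? : Decidable P) where

      count-∁ : ∀ xs → count P? xs + count (∁? P?) xs ≡ length xs
      count-∁ []       = refl
      count-∁ (x ∷ xs) with P? x
      ... | yes _ = cong suc (count-∁ xs)
      ... | no  _ = trans (ℕ.+-suc _ _) (cong suc (count-∁ xs))

      count-none : (∀ x → ¬ P x) → ∀ xs → count P? xs ≡ 0
      count-none ¬P xs = cong length (List.filter-none P? (All.universal ¬P xs))

      count-++ : ∀ xs ys → count P? (xs ++ ys) ≡ count P? xs + count P? ys
      count-++ xs ys = trans (cong length (List.filter-++ P? xs ys)) (List.length-++ (filter P? xs))

  count-map : ∀ {A B : Set} {P : Pred B 0ℓ} (P? : Decidable P) (f : A → B) xs →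
              count P? (map f xs) ≡ count (P? ∘ f) xs
  count-map P? f []       = refl
  count-map P? f (x ∷ xs) with does (P? (f x))
  ... | true  = cong suc (count-map P? f xs)
  ... | false = count-map P? f xs

  length-bitStrings : ∀ k → length (bitStrings k) ≡ 2 ^ k
  length-bitStrings zero    = refl
  length-bitStrings (suc k) =
    trans (List.length-++ (map (true ∷_) (bitStrings k)))
          (cong₂ _+_ half
            (trans (List.length-++ (map (false ∷_) (bitStrings k))) (cong (_+ 0) half)))
    where
    half : ∀ {b} → length (map (b Vec.∷_) (bitStrings k)) ≡ 2 ^ k
    half = trans (List.length-map _ (bitStrings k)) (length-bitStrings k)

  # : ∀ {k} {P : Pred (BitString k) 0ℓ} → Decidable P → ℕ
  # {k} P? = count P? (bitStrings k)

  #-suc : ∀ {k} {P : Pred (BitString (suc k)) 0ℓ} (P? : Decidable P) →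
          # P? ≡ # (P? ∘ (true ∷_)) + # (P? ∘ (false ∷_))
  #-suc {k} P? = begin
    # P?
      ≡⟨ count-++ P? (map (true ∷_) bs) (map (false ∷_) bs ++ []) ⟩
    count P? (map (true ∷_) bs) + count P? (map (false ∷_) bs ++ [])
      ≡⟨ cong₂ _+_ (count-map P? (true ∷_) bs)
           -- The trailing `++ []` is what `cartesianProductWith` leaves at the end of
           -- `true ∷ false ∷ []`.
           (trans (cong (count P?) (List.++-identityʳ (map (false ∷_) bs)))
                  (count-map P? (false ∷_) bs)) ⟩
    # (P? ∘ (true ∷_)) + # (P? ∘ (false ∷_)) ∎
    where
    open ≡-Reasoning
    bs = bitStrings k

  #-∁ : ∀ {k} {P : Pred (BitString k) 0ℓ} (P? : Decidable P) → # P? + # (∁? P?) ≡ 2 ^ k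
  #-∁ {k} P? = trans (count-∁ P? (bitStrings k)) (length-bitStrings k)

  double-≤ : ∀ {m n c} → m ≤ c → n ≤ c → m + n ≤ 2 * c
  double-≤ m≤c n≤c = ℕ.+-mono-≤ m≤c (ℕ.≤-trans n≤c (ℕ.≤-reflexive (sym (ℕ.+-identityʳ _))))

  #-≤ : ∀ {k} {P : Pred (BitString k) 0ℓ} (P? : Decidable P) → # P? ≤ 2 ^ k
  #-≤ P? = ℕ.≤-trans (ℕ.m≤m+n _ _) (ℕ.≤-reflexive (#-∁ P?))

  -- Follow the bits of `v`: at each position, the half of the strings that disagrees with `v`
  -- contributes nothing. This settles the empty prefix in the graph bound below.
  #-subsingleton : ∀ {k} {P : Pred (BitString k) 0ℓ} (P? : Decidable P) v →
                   (∀ x → P x → x ≡ v) → # P? ≤ 1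
  #-subsingleton P? []          _   = #-≤ P?
  #-subsingleton P? (true ∷ v)  P⇒≡ rewrite #-suc P?
    | count-none (P? ∘ (false ∷_)) (λ x p → case P⇒≡ _ p of λ ()) (bitStrings _)
    | ℕ.+-identityʳ (# (P? ∘ (true ∷_))) =
    #-subsingleton (P? ∘ (true ∷_)) v (λ x p → Vec.∷-injectiveʳ (P⇒≡ _ p))
  #-subsingleton P? (false ∷ v) P⇒≡ rewrite #-suc P?
    | count-none (P? ∘ (true ∷_)) (λ x p → case P⇒≡ _ p of λ ()) (bitStrings _) =
    #-subsingleton (P? ∘ (false ∷_)) v (λ x p → Vec.∷-injectiveʳ (P⇒≡ _ p))

  -- Every `ρ` with `P ρ` extends a prefix satisfying `Q`, and each prefix has `2 ^ k` extensions.
  #-take : ∀ m {k} {P : Pred (BitString (m + k)) 0ℓ} {Q : Pred (BitString m) 0ℓ}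
           (P? : Decidable P) (Q? : Decidable Q) →
           (∀ ρ → P ρ → Q (take m ρ)) → # P? ≤ # Q? * 2 ^ k
  #-take zero    {k} P? Q? P⇒Q with Q? []
  ... | yes _ rewrite ℕ.+-identityʳ (2 ^ k) = #-≤ P?
  ... | no ¬q = ℕ.≤-reflexive (count-none P? (λ ρ p → ¬q (P⇒Q ρ p)) (bitStrings k))
  #-take (suc m) {k} P? Q? P⇒Q
    rewrite #-suc P? | #-suc Q?
          | ℕ.*-distribʳ-+ (2 ^ k) (# (Q? ∘ (true ∷_))) (# (Q? ∘ (false ∷_))) =
    ℕ.+-mono-≤ (#-take m (P? ∘ (true ∷_)) (Q? ∘ (true ∷_)) (λ ρ → P⇒Q (true ∷ ρ)))
               (#-take m (P? ∘ (false ∷_)) (Q? ∘ (false ∷_)) (λ ρ → P⇒Q (false ∷ ρ)))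

  -- Once the first `m` bits are fixed, the equation leaves at most one choice for the other `k`.
  #-graph : ∀ m {k} {P : Pred (BitString (m + k)) 0ℓ} (P? : Decidable P)
            (f : BitString m → BitString k) → (∀ ρ → P ρ → drop m ρ ≡ f (take m ρ)) → # P? ≤ 2 ^ m
  #-graph zero    P? f P⇒graph = #-subsingleton P? (f []) P⇒graph
  #-graph (suc m) P? f P⇒graph rewrite #-suc P? =
    double-≤ (#-graph m (P? ∘ (true ∷_)) (f ∘ (true ∷_)) (λ ρ → P⇒graph (true ∷ ρ)))
             (#-graph m (P? ∘ (false ∷_)) (f ∘ (false ∷_)) (λ ρ → P⇒graph (false ∷ ρ)))

  -- Bitwise xor.

  infixl 6 _⊕_
  _⊕_ : ∀ {m} → BitString m → BitString m → BitString m
  _⊕_ = zipWith _xor_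

  ⊕-comm : ∀ {m} (u v : BitString m) → u ⊕ v ≡ v ⊕ u
  ⊕-comm = Vec.zipWith-comm Bool.xor-comm

  ⊕-cancelˡ : ∀ {m} (u v : BitString m) → u ⊕ (u ⊕ v) ≡ v
  ⊕-cancelˡ []      []      = refl
  ⊕-cancelˡ (a ∷ u) (b ∷ v) = cong₂ _∷_ (xor-cancelˡ a b) (⊕-cancelˡ u v)
    where
    xor-cancelˡ : ∀ a b → a xor (a xor b) ≡ b
    xor-cancelˡ true  = Bool.not-involutive
    xor-cancelˡ false = λ _ → refl

  ⊕-transpose : ∀ {m} {u v w : BitString m} → u ⊕ v ≡ w → v ≡ u ⊕ w
  ⊕-transpose {u = u} {v} u⊕v≡w = trans (sym (⊕-cancelˡ u v)) (cong (u ⊕_) u⊕v≡w)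

  ⊕-injectiveʳ : ∀ {m} (u v w : BitString m) → u ⊕ w ≡ v ⊕ w → u ≡ v
  ⊕-injectiveʳ u v w eq = begin
    u           ≡⟨ ⊕-cancelˡ w u ⟨
    w ⊕ (w ⊕ u) ≡⟨ cong (w ⊕_) (trans (⊕-comm w u) (trans eq (⊕-comm v w))) ⟩
    w ⊕ (w ⊕ v) ≡⟨ ⊕-cancelˡ w v ⟩
    v           ∎
    where open ≡-Reasoning

  _≟ᵛ_ : ∀ {k} → DecidableEquality (BitString k)
  _≟ᵛ_ = Vec.≡-dec Bool._≟_

  -- The random linear hash and the union bound.

  module LinearHash (m : ℕ) where

    keyBits : ℕ → ℕ
    keyBits zero    = 0
    keyBits (suc N) = keyBits N + m

    -- The key is an `m` by `N` matrix over GF(2), stored column by column, and the hash is its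
    -- product with the indicator vector of the set; `⊥` serves as the zero vector. The column of
    -- the first element comes last in the key, so that `take` and `drop` split it off.
    hash : ∀ {N} → BitString (keyBits N) → Subset N → BitString m
    hash             ρ []          = ⊥
    hash {N = suc N} ρ (true ∷ S)  = hash (take (keyBits N) ρ) S ⊕ drop (keyBits N) ρ
    hash {N = suc N} ρ (false ∷ S) = hash (take (keyBits N) ρ) S

    Collide : ∀ {N} → Subset N → Subset N → Pred (BitString (keyBits N)) 0ℓ
    Collide S T ρ = hash ρ S ≡ hash ρ T

    collide? : ∀ {N} (S T : Subset N) → Decidable (Collide S T)
    collide? S T ρ = hash ρ S ≟ᵛ hash ρ T

    -- In a collision, the key block at the first position where S and T differ is determined by the
    -- blocks after it.
    #-collide : ∀ {N} (S T : Subset N) → S ≢ T → # (collide? S T) * 2 ^ m ≤ 2 ^ keyBits N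
    #-collide []      []      S≢T = contradiction refl S≢T
    #-collide {suc N} (a ∷ S) (b ∷ T) S≢T = cases a b S≢T
      where
      open ℕ.≤-Reasoning

      -- When the first entries agree, dropping the last block preserves the collision. That block
      -- has `2 ^ m` values, so both sides of the inductive bound gain a factor `2 ^ m`.
      same : ∀ a b → S ≢ T → (∀ ρ → Collide (a ∷ S) (b ∷ T) ρ → Collide S T (take (keyBits N) ρ)) →
             # (collide? (a ∷ S) (b ∷ T)) * 2 ^ m ≤ 2 ^ keyBits (suc N)
      same a b S≢T shrink = begin
        # (collide? (a ∷ S) (b ∷ T)) * 2 ^ m
          ≤⟨ ℕ.*-monoˡ-≤ (2 ^ m) (#-take (keyBits N)
               (collide? (a ∷ S) (b ∷ T)) (collide? S T) shrink) ⟩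
        # (collide? S T) * 2 ^ m * 2 ^ m  ≤⟨ ℕ.*-monoˡ-≤ (2 ^ m) (#-collide S T S≢T) ⟩
        2 ^ keyBits N * 2 ^ m             ≡⟨ ℕ.^-distribˡ-+-* 2 (keyBits N) m ⟨
        2 ^ (keyBits N + m)               ∎

      diff : ∀ a b (f : BitString (keyBits N) → BitString m) →
             (∀ ρ → Collide (a ∷ S) (b ∷ T) ρ → drop (keyBits N) ρ ≡ f (take (keyBits N) ρ)) →
             # (collide? (a ∷ S) (b ∷ T)) * 2 ^ m ≤ 2 ^ keyBits (suc N)
      diff a b f solve = begin
        # (collide? (a ∷ S) (b ∷ T)) * 2 ^ m
          ≤⟨ ℕ.*-monoˡ-≤ (2 ^ m) (#-graph (keyBits N) (collide? (a ∷ S) (b ∷ T)) f solve) ⟩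
        2 ^ keyBits N * 2 ^ m  ≡⟨ ℕ.^-distribˡ-+-* 2 (keyBits N) m ⟨
        2 ^ (keyBits N + m)    ∎

      cases : ∀ a b → a ∷ S ≢ b ∷ T → # (collide? (a ∷ S) (b ∷ T)) * 2 ^ m ≤ 2 ^ keyBits (suc N)
      cases true  true  aS≢bT = same true true (aS≢bT ∘ cong (true ∷_)) (λ ρ → ⊕-injectiveʳ _ _ _)
      cases false false aS≢bT = same false false (aS≢bT ∘ cong (false ∷_)) (λ ρ eq → eq)
      cases true  false _     = diff true false (λ ρ → hash ρ S ⊕ hash ρ T) (λ ρ → ⊕-transpose)
      cases false true  _     = diff false true (λ ρ → hash ρ T ⊕ hash ρ S)
                                  (λ ρ → ⊕-transpose ∘ sym)

    decode : ∀ {N} → BitString (keyBits N) → List (Subset N) → BitString m → Subset N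
    -- A default value, never reached when `c` is the hash of a member of the list.
    decode ρ []       c = ⊥
    decode ρ (T ∷ Ts) c = if does (hash ρ T ≟ᵛ c) then T else decode ρ Ts c

    module _ {N} (S : Subset N) where

      Failure : List (Subset N) → Pred (BitString (keyBits N)) 0ℓ
      Failure Ts ρ = decode ρ Ts (hash ρ S) ≢ S

      failure? : ∀ Ts → Decidable (Failure Ts)
      failure? Ts = ∁? (λ ρ → decode ρ Ts (hash ρ S) ≟ᵛ S)

      failure-head : ∀ Ts ρ → ¬ Failure (S ∷ Ts) ρ
      failure-head Ts ρ fail with hash ρ S ≟ᵛ hash ρ S
      ... | yes _ = fail refl
      ... | no ≢  = ≢ refl

      failure-tail : ∀ T Ts ρ → Failure (T ∷ Ts) ρ → Collide T S ρ ⊎ Failure Ts ρ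
      failure-tail T Ts ρ fail with hash ρ T ≟ᵛ hash ρ S
      ... | yes eq = inj₁ eq
      ... | no _   = inj₂ fail

      -- Each set listed before `S` differs from `S` by `Unique`, so it collides with `S` for at
      -- most one key in `2 ^ m`; once `S` is at the head, no key fails. Multiplying through by
      -- `2 ^ m` keeps the bound in the naturals.
      #-failure : ∀ {Ts} → Unique Ts → S ∈ Ts → # (failure? Ts) * 2 ^ m ≤ length Ts * 2 ^ keyBits N
      #-failure {T ∷ Ts} _ (here refl)
        rewrite count-none (failure? (S ∷ Ts)) (failure-head Ts) (bitStrings (keyBits N)) = z≤n
      #-failure {T ∷ Ts} (T∉Ts ∷ unique) (there S∈Ts) = begin
        # (failure? (T ∷ Ts)) * 2 ^ m
          ≤⟨ ℕ.*-monoˡ-≤ (2 ^ m) (count-⊎ (failure? (T ∷ Ts)) (collide? T S) (failure? Ts)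
               (failure-tail T Ts) (bitStrings (keyBits N))) ⟩
        (# (collide? T S) + # (failure? Ts)) * 2 ^ m
          ≡⟨ ℕ.*-distribʳ-+ (2 ^ m) (# (collide? T S)) _ ⟩
        # (collide? T S) * 2 ^ m + # (failure? Ts) * 2 ^ m
          ≤⟨ ℕ.+-mono-≤ (#-collide T S (All.lookup T∉Ts S∈Ts)) (#-failure unique S∈Ts) ⟩
        2 ^ keyBits N + length Ts * 2 ^ keyBits N ∎
        where open ℕ.≤-Reasoning

-- Rational arithmetic.

module Reals where

  open Counting
  open Defs using (_^_)
  open import Data.Rational.Base using (_<_; _≤_; _+_; _-_; _*_; -_)
  open +-*-Solver using (solve; con; _:=_; _:+_; _:*_; _:-_)

  module Exp = Algebra.Properties.CommutativeSemiring.Exp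
    (CommutativeRing.commutativeSemiring ℚ.+-*-commutativeRing)

  -- The fraction + n / 1, with numerator and denominator that reduce for variable n.
  nat : ℕ → ℚ
  nat n = mkℚ (+ n) 0 (ℕ.sym (1-coprimeTo n))

  /1≡nat : ∀ n → + n / 1 ≡ nat n
  /1≡nat n = ℚ.normalize-coprime (ℕ.sym (1-coprimeTo n))

  nat-+ : ∀ m n → nat (m ℕ.+ n) ≡ nat m + nat n
  nat-+ m n = trans (sym (/1≡nat _))
    (cong (_/ 1) (sym (cong₂ ℤ._+_ (ℤ.*-identityʳ (+ m)) (ℤ.*-identityʳ (+ n)))))

  nat-* : ∀ m n → nat (m ℕ.* n) ≡ nat m * nat n
  nat-* m n = trans (sym (/1≡nat _)) (cong (_/ 1) (ℤ.pos-* m n))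

  nat-mono-≤ : ∀ {m n} → m ℕ.≤ n → nat m ≤ nat n
  nat-mono-≤ m≤n = *≤* (ℤ.*-monoʳ-≤-nonNeg (+ 1) (ℤ.+≤+ m≤n))

  nat-mono-< : ∀ {m n} → m ℕ.< n → nat m < nat n
  nat-mono-< m<n = *<* (ℤ.*-monoʳ-<-pos (+ 1) (ℤ.+<+ m<n))

  -- The denominator is at least one, so the absolute value of the numerator plus one suffices.
  archimedean : ∀ p → ∃[ n ] p < nat n
  archimedean p@(mkℚ z d _) = suc ℤ.∣ z ∣ , *<* (begin-strict
    z ℤ.* + 1                 ≡⟨ ℤ.*-identityʳ z ⟩
    z                         ≤⟨ i≤∣i∣ z ⟩
    + ℤ.∣ z ∣                 <⟨ ℤ.+<+ (ℕ.n<1+n _) ⟩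
    + suc ℤ.∣ z ∣             ≤⟨ ℤ.+≤+ (ℕ.m≤m*n (suc ℤ.∣ z ∣) (suc d)) ⟩
    + (suc ℤ.∣ z ∣ ℕ.* suc d) ≡⟨ ℤ.pos-* (suc ℤ.∣ z ∣) (suc d) ⟩
    + suc ℤ.∣ z ∣ ℤ.* + suc d ∎)
    where
    open ℤ.≤-Reasoning
    i≤∣i∣ : ∀ i → i ℤ.≤ + ℤ.∣ i ∣
    i≤∣i∣ (+ n)    = ℤ.≤-refl
    i≤∣i∣ -[1+ n ] = ℤ.-≤+

  -- Proved on unnormalised rationals, because `_/_` divides by a gcd that does not reduce for
  -- variables.
  /-cancel : ∀ n d .{{_ : ℕ.NonZero d}} → (+ n / d) * nat d ≡ nat n
  /-cancel n (suc d) = ℚ.toℚᵘ-injective (begin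
    toℚᵘ ((+ n / suc d) * nat (suc d))         ≈⟨ ℚ.toℚᵘ-homo-* (+ n / suc d) (nat (suc d)) ⟩
    toℚᵘ (+ n / suc d) ℚᵘ.* toℚᵘ (nat (suc d))
      ≈⟨ ℚᵘ.*-congʳ (ℚ.toℚᵘ-fromℚᵘ (ℚᵘ.mkℚᵘ (+ n) d)) ⟩
    ℚᵘ.mkℚᵘ (+ n) d ℚᵘ.* ℚᵘ.mkℚᵘ (+ suc d) 0   ≈⟨ ℚᵘ.*≡* (ℤ.*-assoc (+ n) (+ suc d) (+ 1)) ⟩
    toℚᵘ (nat n) ∎)
    where open ℚᵘ.≃-Reasoning

  *-monoʳ-< : ∀ {p q r} → 0ℚ < r → p < q → p * r < q * r
  *-monoʳ-< 0<r = ℚ.*-monoˡ-<-pos _ {{positive 0<r}}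

  *-monoʳ-≤ : ∀ {p q r} → 0ℚ ≤ r → p ≤ q → p * r ≤ q * r
  *-monoʳ-≤ 0≤r = ℚ.*-monoʳ-≤-nonNeg _ {{nonNegative 0≤r}}

  *-cancelʳ-< : ∀ {p q r} → 0ℚ < r → p * r < q * r → p < q
  *-cancelʳ-< 0<r = ℚ.*-cancelʳ-<-nonNeg _ {{nonNegative (ℚ.<⇒≤ 0<r)}}

  *-cancelʳ-≤ : ∀ {p q r} → 0ℚ < r → p * r ≤ q * r → p ≤ q
  *-cancelʳ-≤ 0<r = ℚ.*-cancelʳ-≤-pos _ {{positive 0<r}}

  *-pos : ∀ {p q} → 0ℚ < p → 0ℚ < q → 0ℚ < p * q
  *-pos {p} {q} 0<p 0<q = ℚ.positive⁻¹ _ {{ℚ.pos*pos⇒pos p {{positive 0<p}} q {{positive 0<q}}}}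

  *-mono-≤ : ∀ {p q r s} → 0ℚ ≤ r → 0ℚ ≤ q → p ≤ q → r ≤ s → p * r ≤ q * s
  *-mono-≤ {q = q} 0≤r 0≤q p≤q r≤s =
    ℚ.≤-trans (*-monoʳ-≤ 0≤r p≤q) (ℚ.*-monoˡ-≤-nonNeg q {{nonNegative 0≤q}} r≤s)

  *-mono-< : ∀ {p q r s} → 0ℚ < r → 0ℚ < q → p < q → r < s → p * r < q * s
  *-mono-< {q = q} 0<r 0<q p<q r<s =
    ℚ.<-trans (*-monoʳ-< 0<r p<q) (ℚ.*-monoʳ-<-pos q {{positive 0<q}} r<s)

  0<1 : 0ℚ < 1ℚ
  0<1 = *<* (ℤ.+<+ ℕ.≤-refl)

  ^-pos : ∀ {p} n → 0ℚ < p → 0ℚ < p ^ n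
  ^-pos zero    0<p = 0<1
  ^-pos (suc n) 0<p = *-pos 0<p (^-pos n 0<p)

  ^-mono-≤ : ∀ {p q} n → 0ℚ < p → p ≤ q → p ^ n ≤ q ^ n
  ^-mono-≤ zero    0<p p≤q = ℚ.≤-refl
  ^-mono-≤ (suc n) 0<p p≤q =
    *-mono-≤ (ℚ.<⇒≤ (^-pos n 0<p)) (ℚ.≤-trans (ℚ.<⇒≤ 0<p) p≤q) p≤q (^-mono-≤ n 0<p p≤q)

  ^-mono-< : ∀ {p q} n .{{_ : ℕ.NonZero n}} → 0ℚ < p → p < q → p ^ n < q ^ n
  ^-mono-< (suc zero)    0<p p<q = *-monoʳ-< 0<1 p<q
  ^-mono-< (suc (suc n)) 0<p p<q =
    *-mono-< (^-pos (suc n) 0<p) (ℚ.<-trans 0<p p<q) p<q (^-mono-< (suc n) 0<p p<q)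

  nat-^ : ∀ m n → nat (m ℕ.^ n) ≡ nat m ^ n
  nat-^ m zero    = refl
  nat-^ m (suc n) = trans (nat-* m (m ℕ.^ n)) (cong (nat m *_) (nat-^ m n))

  -- Powers of two with integer and rational exponents.

  2ℚ : ℚ
  2ℚ = + 2 / 1

  0<2 : 0ℚ < 2ℚ
  0<2 = *<* (ℤ.+<+ (s≤s z≤n))

  0<½ : 0ℚ < ½
  0<½ = *<* (ℤ.+<+ (s≤s z≤n))

  1≤2^ : ∀ n → 1ℚ ≤ 2ℚ ^ n
  1≤2^ n = subst (1ℚ ≤_) (nat-^ 2 n) (nat-mono-≤ (ℕ.m^n>0 2 n))

  -- Each common successor cancels a factor `2ℚ * ½`. Exponents of opposite signs add by `_⊖_`, so
  -- this is the mixed case of `2^ℤ-+`.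
  2^ℤ-⊖ : ∀ m n → 2^ℤ (m ⊖ n) ≡ 2ℚ ^ m * ½ ^ n
  2^ℤ-⊖ zero    zero    = refl
  2^ℤ-⊖ (suc m) zero    = sym (ℚ.*-identityʳ _)
  2^ℤ-⊖ zero    (suc n) = sym (ℚ.*-identityˡ _)
  2^ℤ-⊖ (suc m) (suc n) rewrite ℤ.[1+m]⊖[1+n]≡m⊖n m n = trans (2^ℤ-⊖ m n)
    (solve 2 (λ x y → x :* y := (con 2ℚ :* x) :* (con ½ :* y)) refl (2ℚ ^ m) (½ ^ n))

  2^ℤ-+ : ∀ i j → 2^ℤ (i ℤ.+ j) ≡ 2^ℤ i * 2^ℤ j
  2^ℤ-+ (+ m)    (+ n)    = Exp.^-homo-* 2ℚ m n
  2^ℤ-+ (+ m)    -[1+ n ] = 2^ℤ-⊖ m (suc n)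
  2^ℤ-+ -[1+ m ] (+ n)    = trans (2^ℤ-⊖ n (suc m)) (ℚ.*-comm (2ℚ ^ n) (½ ^ suc m))
  2^ℤ-+ -[1+ m ] -[1+ n ] = trans (cong (λ k → ½ ^ suc k) (sym (ℕ.+-suc m n)))
                                  (Exp.^-homo-* ½ (suc m) (suc n))

  2^ℤ-* : ∀ i n → 2^ℤ (i ℤ.* + n) ≡ (2^ℤ i) ^ n
  2^ℤ-* i zero    rewrite ℤ.*-zeroʳ i = refl
  2^ℤ-* i (suc n) rewrite ℤ.*-suc i (+ n) =
    trans (2^ℤ-+ i (i ℤ.* + n)) (cong (2^ℤ i *_) (2^ℤ-* i n))

  2^ℤ-pos : ∀ i → 0ℚ < 2^ℤ i
  2^ℤ-pos (+ n)    = ^-pos n 0<2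
  2^ℤ-pos -[1+ n ] = ^-pos (suc n) 0<½

  -- The quotient of the two powers is `2ℚ ^ ∣ j - i ∣`, which is at least one.
  2^ℤ-mono-≤ : ∀ {i j} → i ℤ.≤ j → 2^ℤ i ≤ 2^ℤ j
  2^ℤ-mono-≤ {i} {j} i≤j = begin
    2^ℤ i                      ≡⟨ ℚ.*-identityˡ _ ⟨
    1ℚ * 2^ℤ i                 ≤⟨ *-monoʳ-≤ (ℚ.<⇒≤ (2^ℤ-pos i)) (1≤2^ ℤ.∣ j ℤ.- i ∣) ⟩
    2^ℤ (+ ℤ.∣ j ℤ.- i ∣) * 2^ℤ i ≡⟨ 2^ℤ-+ (+ ℤ.∣ j ℤ.- i ∣) i ⟨
    2^ℤ (+ ℤ.∣ j ℤ.- i ∣ ℤ.+ i)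
      ≡⟨ cong (λ k → 2^ℤ (k ℤ.+ i)) (ℤ.0≤i⇒+∣i∣≡i (ℤ.i≤j⇒0≤j-i i≤j)) ⟩
    2^ℤ (j ℤ.- i ℤ.+ i)        ≡⟨ cong 2^ℤ_ (trans (ℤ.+-assoc j (ℤ.- i) i)
                                    (trans (cong (λ k → j ℤ.+ k) (ℤ.+-inverseˡ i))
                                           (ℤ.+-identityʳ j))) ⟩
    2^ℤ j                      ∎
    where open ℚ.≤-Reasoning

  -- The hypothesis cleared of denominators, without reducing the sum to lowest terms; this is the
  -- comparison of exponents that `*<2^` needs.
  +<nat⇒ : ∀ r e m → r + e < nat m →
           ↥ r ℤ.* ↧ e ℤ.+ ↥ e ℤ.* ↧ r ℤ.≤ + m ℤ.* + (↧ₙ r ℕ.* ↧ₙ e)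
  +<nat⇒ r@record{} e@record{} m r+e<m =
    subst (λ z → z ℤ.≤ + m ℤ.* + (↧ₙ r ℕ.* ↧ₙ e)) (ℤ.*-identityʳ _)
      (ℤ.<⇒≤ (ℚᵘ.drop-*<* (ℚᵘ.<-respˡ-≃ (ℚ.toℚᵘ-homo-+ r e) (ℚ.toℚᵘ-mono-< r+e<m))))

  -- x < 2^r and s < 2^e give x s < 2^(r + e); both sides are raised to the product of the
  -- denominators of r and e.
  *<2^ : ∀ {x s} r e m → 0ℚ < x → 0ℚ < s →
         x ^ ↧ₙ r < 2^ℤ (↥ r) → s ^ ↧ₙ e < 2^ℤ (↥ e) → r + e < nat m → x * s < 2ℚ ^ m
  *<2^ {x} {s} r@record{} e@record{} m 0<x 0<s x<2^r s<2^e r+e<m =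
    -- Arguing by contradiction lets monotonicity of powers be used forwards, so no roots are taken.
    ℚ.≰⇒> (λ 2^m≤xs → ℚ.<-irrefl refl (begin-strict
      (2ℚ ^ m) ^ D                                ≤⟨ ^-mono-≤ D (^-pos m 0<2) 2^m≤xs ⟩
      (x * s) ^ D                                 ≡⟨ Exp.^-distrib-* x s D ⟩
      x ^ D * s ^ D
        <⟨ *-mono-< (^-pos D 0<s) (2^ℤ-pos (↥ r ℤ.* ↧ e))
             (raise {x} (↧ₙ r) (↧ₙ e) (↥ r) refl 0<x x<2^r)
             (raise {s} (↧ₙ e) (↧ₙ r) (↥ e) (ℕ.*-comm (↧ₙ e) (↧ₙ r)) 0<s s<2^e) ⟩
      2^ℤ (↥ r ℤ.* ↧ e) * 2^ℤ (↥ e ℤ.* ↧ r)       ≡⟨ 2^ℤ-+ (↥ r ℤ.* ↧ e) (↥ e ℤ.* ↧ r) ⟨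
      2^ℤ (↥ r ℤ.* ↧ e ℤ.+ ↥ e ℤ.* ↧ r)           ≤⟨ 2^ℤ-mono-≤ (+<nat⇒ r e m r+e<m) ⟩
      2^ℤ (+ m ℤ.* + D)                           ≡⟨ 2^ℤ-* (+ m) D ⟩
      (2ℚ ^ m) ^ D                                ∎))
    where
    open ℚ.≤-Reasoning
    D = ↧ₙ r ℕ.* ↧ₙ e
    -- The product is a separate `D`, so that both orders of the two denominators lead to the same
    -- exponent.
    raise : ∀ {y} d d′ .{{_ : ℕ.NonZero d}} .{{_ : ℕ.NonZero d′}} i {D} → d ℕ.* d′ ≡ D →
            0ℚ < y → y ^ d < 2^ℤ i → y ^ D < 2^ℤ (i ℤ.* + d′)
    raise {y} d d′ i refl 0<y y^d<2^i = subst₂ _<_ (Exp.^-assocʳ y d d′) (sym (2^ℤ-* i d′))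
      (^-mono-< d′ (^-pos d 0<y) y^d<2^i)

  -- Cuts for `lg (1/δ)`, the competitive ratio and the admissible list length.

  0<q-p : ∀ {p q} → p < q → 0ℚ < q - p
  0<q-p {p} {q} p<q = subst (_< q - p) (ℚ.+-inverseʳ p) (ℚ.+-monoˡ-< (- p) p<q)

  0<q-p⇒p<q : ∀ {p q} → 0ℚ < q - p → p < q
  0<q-p⇒p<q {p} {q} 0<q-p = subst₂ _<_ (ℚ.+-identityˡ p)
    (solve 2 (λ p q → q :- p :+ p := q) refl p q) (ℚ.+-monoˡ-< p 0<q-p)

  reciprocal : ∀ {p} → 0ℚ < p → ∃[ q ] 0ℚ < q × q * p ≡ 1ℚ
  reciprocal {p} 0<p = 1/ p , ℚ.positive⁻¹ _ {{ℚ.1/pos⇒pos p}} , ℚ.*-inverseˡ p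
    where
    instance
      p-positive = positive 0<p
      p-nonZero  = ℚ.pos⇒nonZero p

  -- Roundedness makes `L x` downward closed, so `q ≤ p` would put `q` on both sides of the cut.
  L<U : ∀ {x} → IsReal x → ∀ {p q} → L x p → U x q → p < q
  L<U {x} real {p} {q} Lp Uq with ℚ.<-cmp p q
  ... | tri< p<q _ _  = p<q
  ... | tri≈ _ refl _ = contradiction (Lp , Uq) (IsReal.disjoint real p)
  ... | tri> _ _ q<p  = contradiction
          (Equivalence.from (IsReal.rounded-L real q) (p , q<p , Lp) , Uq) (IsReal.disjoint real q)

  -- 2 - t serves as a number between 1 and 1/t, since (2 - t) t = 1 - (1 - t)².
  0∈lg[1÷δ] : ∀ {δ} → δ <ᶜ fromℕ 1 → L (lg (fromℕ 1 ÷ᶜ δ)) 0ℚ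
  0∈lg[1÷δ] (t , Ut , t<1) = 2ℚ - t , (a , t , a<1 , Ut , st<a) , ℚ.<-trans 0<1 1<s , 1<s^1
    where
    1<s : 1ℚ < 2ℚ - t
    1<s = 0<q-p⇒p<q (subst (0ℚ <_) (solve 1 (λ t → con 1ℚ :- t := con 2ℚ :- t :- con 1ℚ) refl t)
      (0<q-p t<1))
    1<s^1 : 1ℚ < (2ℚ - t) * 1ℚ
    1<s^1 = subst (1ℚ <_) (sym (ℚ.*-identityʳ _)) 1<s
    st<1 : (2ℚ - t) * t < 1ℚ
    st<1 = 0<q-p⇒p<q (subst (0ℚ <_)
      (solve 1 (λ t → (con 1ℚ :- t) :* (con 1ℚ :- t) := con 1ℚ :- (con 2ℚ :- t) :* t) refl t)
      (*-pos (0<q-p t<1) (0<q-p t<1)))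
    between = ℚ.<-dense st<1
    a    = proj₁ between
    st<a = proj₁ (proj₂ between)
    a<1  = proj₂ (proj₂ between)

  -- Since `0 < lg (1/δ)`, every rational above `m` is an upper bound of `m - lg (1/δ)`; it remains
  -- to choose one close enough to `m`.
  1≤competitiveness : ∀ {δ} → δ <ᶜ fromℕ 1 → ∀ {m} → 1 ℕ.≤ m → fromℕ 1 ≤ᶜ competitiveness δ m
  1≤competitiveness {δ} δ<1 {m} 1≤m q q<1 =
    a , m′ + (1ℚ - q) , a<m , (b , 0ℚ , m<b , 0∈lg[1÷δ] {δ} δ<1 , b-0<) , qb<a
    where
    m′ = + m / 1
    1≤m′ : 1ℚ ≤ m′
    1≤m′ = subst (1ℚ ≤_) (sym (/1≡nat m)) (nat-mono-≤ 1≤m)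
    -- The excess `1 - q` makes `m - q (m + 1 - q)` factor as `(1 - q) (m - q)`, positive because
    -- `q < 1 ≤ m`.
    qb<m : q * (m′ + (1ℚ - q)) < m′
    qb<m = 0<q-p⇒p<q (subst (0ℚ <_)
      (solve 2 (λ q m → (con 1ℚ :- q) :* (m :- q) := m :- q :* (m :+ (con 1ℚ :- q))) refl q m′)
      (*-pos (0<q-p q<1) (0<q-p (ℚ.<-≤-trans q<1 1≤m′))))
    m<m+1-q : m′ < m′ + (1ℚ - q)
    m<m+1-q = subst (_< m′ + (1ℚ - q)) (ℚ.+-identityʳ m′) (ℚ.+-monoʳ-< m′ (0<q-p q<1))
    between₁ = ℚ.<-dense qb<m
    a    = proj₁ between₁
    qb<a = proj₁ (proj₂ between₁)
    a<m  = proj₂ (proj₂ between₁)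
    between₂ = ℚ.<-dense m<m+1-q
    b   = proj₁ between₂
    m<b = proj₁ (proj₂ between₂)
    b-0< : b - 0ℚ < m′ + (1ℚ - q)
    b-0< = subst (_< m′ + (1ℚ - q)) (sym (ℚ.+-identityʳ b)) (proj₂ (proj₂ between₂))

  -- The chain `1/b < 1/δ < s < 2^e` without divisions: some lower bound `f` of `δ` has `1 < s f`,
  -- and `f < b`.
  U-lg[1÷δ]⇒ : ∀ {δ} → IsReal δ → ∀ {b e} → U δ b → U (lg (fromℕ 1 ÷ᶜ δ)) e →
               ∃[ s ] 0ℚ < s × 1ℚ < b * s × s ^ ↧ₙ e < 2^ℤ (↥ e)
  U-lg[1÷δ]⇒ real {b} {e} Ub (s , (a , f , 1<a , Lf , 0<f , a<sf) , s<2^e) =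
    s , 0<s , 1<bs , bound s<2^e
    where
    1<sf : 1ℚ < s * f
    1<sf = ℚ.<-trans 1<a a<sf
    0<s : 0ℚ < s
    0<s = *-cancelʳ-< 0<f (subst (_< s * f) (sym (ℚ.*-zeroˡ f)) (ℚ.<-trans 0<1 1<sf))
    1<bs : 1ℚ < b * s
    1<bs = ℚ.<-trans (subst (1ℚ <_) (ℚ.*-comm s f) 1<sf) (*-monoʳ-< 0<s (L<U real Lf Ub))
    bound : s <2^ e → s ^ ↧ₙ e < 2^ℤ (↥ e)
    bound (inj₁ s≤0)  = contradiction (ℚ.<-≤-trans 0<s s≤0) (ℚ.<-irrefl refl)
    bound (inj₂ s<2^) = s<2^

  -- The half `m/α ≤ m - lg (1/δ)` of the identity defining `α`. With `b` above `α` and `c` below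
  -- `m - lg (1/δ)`, the cuts give `r b < m < b c`, and cancelling `b` leaves `r < c`.
  L-÷ᶜ-competitiveness⇒ : ∀ {δ} m {r} → L (fromℕ m ÷ᶜ competitiveness δ m) r →
                          ∃[ e ] U (lg (fromℕ 1 ÷ᶜ δ)) e × r + e < nat m
  L-÷ᶜ-competitiveness⇒ m {r}
    (a , b , a<m , (a′ , c , m<a′ , (d , e , d<m , Ue , c<d-e) , 0<c , a′<bc) , rb<a) =
    e , Ue , r+e<m
    where
    open ℚ.≤-Reasoning
    m<bc : + m / 1 < b * c
    m<bc = ℚ.<-trans m<a′ a′<bc
    0≤m : 0ℚ ≤ + m / 1
    0≤m = subst (0ℚ ≤_) (sym (/1≡nat m)) (nat-mono-≤ z≤n)
    0<b : 0ℚ < b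
    0<b = *-cancelʳ-< 0<c (subst (_< b * c) (sym (ℚ.*-zeroˡ c)) (ℚ.≤-<-trans 0≤m m<bc))
    r<c : r < c
    r<c = *-cancelʳ-< 0<b (begin-strict
      r * b   <⟨ rb<a ⟩
      a       <⟨ a<m ⟩
      + m / 1 <⟨ m<bc ⟩
      b * c   ≡⟨ ℚ.*-comm b c ⟩
      c * b   ∎)
    r+e<m : r + e < nat m
    r+e<m = begin-strict
      r + e     <⟨ ℚ.+-monoˡ-< e (ℚ.<-trans r<c c<d-e) ⟩
      d - e + e ≡⟨ solve 2 (λ d e → d :- e :+ e := d) refl d e ⟩
      d         <⟨ d<m ⟩
      + m / 1   ≡⟨ /1≡nat m ⟩
      nat m     ∎

  -- If `x = b 2^m` were below `n`, it would be a lower bound of `2^(m/α)`, so `x < 2^r` for some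
  -- `r < m/α`. Taking `e > lg (1/δ)` with `r + e < m`, and `s < 2^e` with `1 < b s`, gives both
  -- `x s < 2^m` and `2^m < x s`.
  length-bound : ∀ {δ} → IsReal δ → fromℕ 0 <ᶜ δ → ∀ {n m} →
                 fromℕ n ≤ᶜ 2^ᶜ (fromℕ m ÷ᶜ competitiveness δ m) →
                 ∀ {b} → U δ b → nat n ≤ b * 2ℚ ^ m
  length-bound {δ} real (f , 0<f , Lf) {n} {m} n≤2^ {b} Ub = ℚ.≮⇒≥ λ x<n →
    contra (n≤2^ (b * 2ℚ ^ m) (subst (b * 2ℚ ^ m <_) (sym (/1≡nat n)) x<n))
    where
    x = b * 2ℚ ^ m
    0<x : 0ℚ < x
    0<x = *-pos (ℚ.<-trans 0<f (L<U real Lf Ub)) (^-pos m 0<2)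
    contra : L (2^ᶜ (fromℕ m ÷ᶜ competitiveness δ m)) x → Empty.⊥
    -- Excluded because `b > δ > 0`.
    contra (r , Lr , inj₁ x≤0) = ℚ.<-irrefl refl (ℚ.<-≤-trans 0<x x≤0)
    contra (r , Lr , inj₂ x<2^r) =
      let e , Ue , r+e<m         = L-÷ᶜ-competitiveness⇒ {δ} m {r} Lr
          s , 0<s , 1<bs , s<2^e = U-lg[1÷δ]⇒ {δ} real {b} {e} Ub Ue
      in ℚ.<-asym (*<2^ {x} {s} r e m 0<x 0<s x<2^r s<2^e r+e<m) (begin-strict
        2ℚ ^ m           ≡⟨ ℚ.*-identityˡ _ ⟨
        1ℚ * 2ℚ ^ m      <⟨ *-monoʳ-< {1ℚ} {b * s} {2ℚ ^ m} (^-pos m 0<2) 1<bs ⟩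
        b * s * 2ℚ ^ m   ≡⟨ solve 3 (λ b s t → b :* s :* t := b :* t :* s) refl b s (2ℚ ^ m) ⟩
        x * s            ∎)
      where open ℚ.≤-Reasoning

  -- From counts to probabilities, and the scheme.

  Pr*2^k : ∀ {k} {P : Pred (BitString k) 0ℓ} (P? : Decidable P) → Pr P? * nat (2 ℕ.^ k) ≡ nat (# P?)
  Pr*2^k {k} P? = /-cancel (# P?) (2 ℕ.^ k)
    where instance _ = ℕ.m^n≢0 2 k

  1-b≤Pr : ∀ {k} {P : Pred (BitString k) 0ℓ} (P? : Decidable P) {b} →
        nat (# (∁? P?)) ≤ b * nat (2 ℕ.^ k) → 1ℚ - b ≤ Pr P?
  1-b≤Pr {k} P? {b} few = *-cancelʳ-≤ {r = D} 0<D (begin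
    (1ℚ - b) * D          ≡⟨ solve 2 (λ b D → (con 1ℚ :- b) :* D := D :- b :* D) refl b D ⟩
    D - b * D             ≤⟨ ℚ.+-monoʳ-≤ D (ℚ.neg-antimono-≤ few) ⟩
    D - F                 ≡⟨ cong (_- F) D≡G+F ⟩
    G + F - F             ≡⟨ solve 2 (λ G F → G :+ F :- F := G) refl G F ⟩
    G                     ≡⟨ Pr*2^k P? ⟨
    Pr P? * D             ∎)
    where
    open ℚ.≤-Reasoning
    D = nat (2 ℕ.^ k)
    F = nat (# (∁? P?))
    G = nat (# P?)
    0<D : 0ℚ < D
    0<D = nat-mono-< (ℕ.m^n>0 2 k)
    D≡G+F : D ≡ G + F
    D≡G+F = trans (cong nat (sym (#-∁ P?))) (nat-+ (# P?) (# (∁? P?)))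

  linearScheme : ∀ N m → Scheme N m
  linearScheme N m = record
    { randomBits = keyBits N
    ; Enc        = hash
    ; Dec        = λ ρ Ss → decode ρ (proj₁ Ss)
    }
    where open LinearHash m

  linearScheme-competitive : ∀ {δ} → IsReal δ → fromℕ 0 <ᶜ δ → δ <ᶜ fromℕ 1 → ∀ N {m} → 1 ℕ.≤ m →
                             IsCompetitive (linearScheme N m) (competitiveness δ m) δ
  linearScheme-competitive {δ} real 0<δ δ<1 N {m} 1≤m = record
    { 1≤α     = 1≤competitiveness {δ} δ<1 1≤m
    ; correct = correct
    }
    where
    open LinearHash m
    open Scheme (linearScheme N m) using (success?)
    open ℚ.≤-Reasoning

    -- The factor `2 ^ m` of the union bound cancels against the one in the bound on the list
    -- length.
    few : ∀ (Ss : SubsetList N) {S} → S ∈ proj₁ Ss → ∀ {b} → nat (length (proj₁ Ss)) ≤ b * 2ℚ ^ m →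
          nat (# (∁? (success? Ss S))) ≤ b * nat (2 ℕ.^ keyBits N)
    few (Ts , unique) {S} S∈Ts {b} n≤b2^m = *-cancelʳ-≤ (^-pos m 0<2) (begin
      F * 2ℚ ^ m                                ≡⟨ cong (F *_) (nat-^ 2 m) ⟨
      F * nat (2 ℕ.^ m)                         ≡⟨ nat-* (# (failure? S Ts)) (2 ℕ.^ m) ⟨
      nat (# (failure? S Ts) ℕ.* 2 ℕ.^ m)       ≤⟨ nat-mono-≤ (#-failure S unique S∈Ts) ⟩
      nat (length Ts ℕ.* 2 ℕ.^ keyBits N)       ≡⟨ nat-* (length Ts) (2 ℕ.^ keyBits N) ⟩
      nat (length Ts) * D                       ≤⟨ *-monoʳ-≤ (nat-mono-≤ z≤n) n≤b2^m ⟩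
      b * 2ℚ ^ m * D
        ≡⟨ solve 3 (λ b t D → b :* t :* D := b :* D :* t) refl b (2ℚ ^ m) D ⟩
      b * D * 2ℚ ^ m                            ∎)
      where
      F = nat (# (failure? S Ts))
      D = nat (2 ℕ.^ keyBits N)

    correct : (Ss : SubsetList N) →
              fromℕ (length (proj₁ Ss)) ≤ᶜ 2^ᶜ (fromℕ m ÷ᶜ competitiveness δ m) →
              ∀ S → S ∈ proj₁ Ss → fromℕ 1 -ᶜ δ ≤ᶜ fromℚ (Pr (success? Ss S))
    correct Ss n≤2^ S S∈Ss q (a , b , a<1 , Ub , q<a-b) = begin-strict
      q                  <⟨ q<a-b ⟩
      a - b              <⟨ ℚ.+-monoˡ-< (- b) a<1 ⟩
      1ℚ - b
        ≤⟨ 1-b≤Pr (success? Ss S) {b} (few Ss S∈Ss {b} (length-bound real 0<δ {m = m} n≤2^ Ub)) ⟩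
      Pr (success? Ss S) ∎

  -- Convergence of the competitive ratio to 1.

  nat∈U-lg[1÷δ] : ∀ {δ} → fromℕ 0 <ᶜ δ → ∃[ K ] U (lg (fromℕ 1 ÷ᶜ δ)) (nat K)
  nat∈U-lg[1÷δ] {δ} (f , 0<f , Lf) =
    -- Here `s = 2/f` exceeds `1/δ`, and `K > s` gives `s < K < 2^K`. The number 3/2 lies strictly
    -- between 1 and `s f = 2`.
    K , s , (+ 3 / 2 , f , *<* (ℤ.+<+ ℕ.≤-refl) , Lf , 0<f , 3/2<sf) , inj₂ s<2^K
    where
    inverse = reciprocal 0<f
    s = 2ℚ * proj₁ inverse
    sf≡2 : s * f ≡ 2ℚ
    sf≡2 = trans (ℚ.*-assoc 2ℚ (proj₁ inverse) f) (cong (2ℚ *_) (proj₂ (proj₂ inverse)))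
    3/2<sf : + 3 / 2 < s * f
    3/2<sf = subst (+ 3 / 2 <_) (sym sf≡2) (*<* (ℤ.+<+ ℕ.≤-refl))
    K = proj₁ (archimedean s)
    s<2^K : s * 1ℚ < 2ℚ ^ K
    s<2^K = begin-strict
      s * 1ℚ       ≡⟨ ℚ.*-identityʳ s ⟩
      s            <⟨ proj₂ (archimedean s) ⟩
      nat K        ≤⟨ nat-mono-≤ (ℕ.<⇒≤ (n<2^n K)) ⟩
      nat (2 ℕ.^ K) ≡⟨ nat-^ 2 K ⟩
      2ℚ ^ K       ∎
      where
      open ℚ.≤-Reasoning
      n<2^n : ∀ n → n ℕ.< 2 ℕ.^ n
      n<2^n zero    = s≤s z≤n
      n<2^n (suc n) = ℕ.≤-trans (ℕ.+-mono-≤ (ℕ.m^n>0 2 n) (n<2^n n))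
                                (ℕ.+-monoʳ-≤ (2 ℕ.^ n) (ℕ.m≤m+n _ 0))

  -- With t = m - (K + 1) > y, where η y = K + 1, we have m = t + η y < (1 + η) t.
  competitiveness<1+η : ∀ {δ} K → U (lg (fromℕ 1 ÷ᶜ δ)) (nat K) → ∀ {η y} → 0ℚ < η → 0ℚ < y →
                        y * η ≡ nat K + 1ℚ → ∀ m → nat K + 1ℚ + y < + m / 1 →
                        U (competitiveness δ m) (1ℚ + η)
  competitiveness<1+η K U-K {η} {y} 0<η 0<y yη≡K+1 m K+1+y<m =
    -- Subtracting `K + 1` rather than `K` leaves room for two strict inequalities, one half each:
    -- `m - ½ < m` and `t < m - ½ - K`.
    a , t , m<a , (m′ - ½ , nat K , m-½<m , U-K , t<m-½-K) , ℚ.<-trans 0<y y<t , a<[1+η]t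
    where
    m′ = + m / 1
    t = m′ - (nat K + 1ℚ)
    y<t : y < t
    y<t = 0<q-p⇒p<q (subst (0ℚ <_)
      (solve 3 (λ m k y → m :- (k :+ y) := m :- k :- y) refl m′ (nat K + 1ℚ) y) (0<q-p K+1+y<m))
    m-½<m : m′ - ½ < m′
    m-½<m = 0<q-p⇒p<q (subst (0ℚ <_) (solve 1 (λ m → con ½ := m :- (m :- con ½)) refl m′) 0<½)
    t<m-½-K : t < m′ - ½ - nat K
    t<m-½-K = 0<q-p⇒p<q (subst (0ℚ <_)
      (solve 2 (λ m K → con ½ := m :- con ½ :- K :- (m :- (K :+ con 1ℚ))) refl m′ (nat K)) 0<½)
    m<[1+η]t : m′ < (1ℚ + η) * t
    m<[1+η]t = 0<q-p⇒p<q (subst (0ℚ <_)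
      (trans (cong (λ z → t * η - z) yη≡K+1)
        (solve 3 (λ m k η → (m :- k) :* η :- k := (con 1ℚ :+ η) :* (m :- k) :- m)
          refl m′ (nat K + 1ℚ) η))
      (0<q-p (*-monoʳ-< {y} {t} {η} 0<η y<t)))
    between  = ℚ.<-dense m<[1+η]t
    a        = proj₁ between
    m<a      = proj₁ (proj₂ between)
    a<[1+η]t = proj₂ (proj₂ between)

  competitiveness⟶1 : ∀ {δ} → fromℕ 0 <ᶜ δ → δ <ᶜ fromℕ 1 → competitiveness δ ⟶ 1ℚ
  competitiveness⟶1 {δ} 0<δ δ<1 ε 0<ε =
    let K , U-K        = nat∈U-lg[1÷δ] {δ} 0<δ
        -- A strictly smaller `η` makes `1 + η` a rational witness between the ratio and `1 + ε`.
        η , 0<η , η<ε  = ℚ.<-dense 0<ε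
        i , 0<i , iη≡1 = reciprocal 0<η
        y              = (nat K + 1ℚ) * i
        M , K+1+y<M    = archimedean (nat K + 1ℚ + y)
    -- The successor ensures `1 ≤ m`, under which the ratio is known to be at least 1.
    in suc M , λ m M<m →
       lower (ℕ.≤-trans (s≤s z≤n) M<m) ,
       (1ℚ + η ,
        competitiveness<1+η {δ} K U-K {η} {y} 0<η (*-pos {nat K + 1ℚ} {i} (0<K+1 K) 0<i)
          (trans (ℚ.*-assoc (nat K + 1ℚ) i η)
            (trans (cong ((nat K + 1ℚ) *_) iη≡1) (ℚ.*-identityʳ (nat K + 1ℚ))))
          m (ℚ.<-≤-trans K+1+y<M (subst (nat M ≤_) (sym (/1≡nat m)) (nat-mono-≤ (ℕ.<⇒≤ M<m)))) ,
        ℚ.+-monoʳ-< 1ℚ η<ε)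
    where
    0<K+1 : ∀ K → 0ℚ < nat K + 1ℚ
    0<K+1 K = ℚ.+-mono-≤-< (nat-mono-≤ {0} {K} z≤n) 0<1

    1-ε<1 : 1ℚ - ε < 1ℚ
    1-ε<1 = 0<q-p⇒p<q (subst (0ℚ <_) (solve 1 (λ ε → ε := con 1ℚ :- (con 1ℚ :- ε)) refl ε) 0<ε)

    lower : ∀ {m} → 1 ℕ.≤ m → fromℚ (1ℚ - ε) <ᶜ competitiveness δ m
    lower {m} 1≤m =
      let q , 1-ε<q , q<1 = ℚ.<-dense 1-ε<1
      in q , 1-ε<q , 1≤competitiveness {δ} δ<1 {m} 1≤m q q<1

open import Data.Nat.Base using (_≤_)
open Reals using (linearScheme; linearScheme-competitive; competitiveness⟶1)

theorem1p4 : (δ : Cut) → IsReal δ → fromℕ 0 <ᶜ δ → δ <ᶜ fromℕ 1 →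
    (∀ (N m : ℕ) → 1 ≤ N → 1 ≤ m → lg (fromℕ 1 ÷ᶜ δ) <ᶜ fromℕ m →
    ∃[ 𝓢 ] IsCompetitive {N} {m} 𝓢 (competitiveness δ m) δ)
    × (competitiveness δ ⟶ 1ℚ)
theorem1p4 δ real 0<δ δ<1 =
  (λ N m _ 1≤m _ → linearScheme N m , linearScheme-competitive real 0<δ δ<1 N 1≤m) ,
  competitiveness⟶1 {δ} 0<δ δ<1
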